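{- For every $n\geq 2$, the ladder graph $L_n$ satisfies $\mathcal{R}(L_n)=2$. Consequently, every ladder graph $L_n$ ($n\geq 1$) is a circle graph.
   Context: All graphs are finite and simple. For a word $w$ and distinct letters $x,y$ occurring in $w$, $x$ and $y$ alternate in $w$ if deleting all letters other than copies of $x$ and $y$ yields a word of the form $xyxy\cdots$ or $yxyx\cdots$ (of even or odd length). A graph $G=(V,E)$ is word-representable if there is a word $w$ over $V$ (each vertex occurring in $w$) such that for all distinct $x,y\in V$, $x$ and $y$ alternate in $w$ iff $(x,y)\in E$. A word is $k$-uniform if each letter occurs exactly $k$ times; $G$ is $k$-word-representable if some $k$-uniform word represents it; the representation number $\mathcal{R}(G)$ is the least such $k$. The ladder graph $L_n$ has vertices $1,\ldots,n,1',\ldots,n'$ and the $3n-2$ edges $(i,i+1)$ and $(i',(i+1)')$ for $1\leq i\leq n-1$ and $(i,i')$ for $1\leq i\leq n$. A circle graph is a graph whose vertices can be associated with chords of a circle so that two vertices are adjacent iff their chords cross. -}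

module Defs where

open import Data.Fin using (Fin; toℕ)
import Data.Fin.Properties as Fin
open import Data.List using (List; []; _∷_; filter; length)
open import Data.List.Membership.Propositional using (_∈_)
open import Data.Nat using (ℕ; zero; suc; _≤_)
import Data.Nat as ℕ
import Data.Nat.Properties as ℕ
open import Data.Product using (Σ-syntax; ∃-syntax; _×_; _,_)
open import Data.Rational using (ℚ; 0ℚ; 1ℚ; _+_; _-_; _*_; _<_)
open import Data.Sum using (_⊎_; inj₁; inj₂)
open import Function using (_↔_; _⇔_)
open import Function.Properties.Inverse using (↔⇒↣; ↔-sym)
open import Level using (0ℓ)
open import Relation.Binary using (Rel; Irreflexive; Symmetric; DecidableEquality)
open import Relation.Binary.Construct.Closure.Symmetric as SymClosure using (SymClosure; fwd; bwd)
open import Relation.Binary.PropositionalEquality using (_≡_; _≢_; refl; sym)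
open import Relation.Nullary.Decidable using (_⊎-dec_; via-injection)

------------------------------------------------------------------------
-- Finite simple graphs

record Graph : Set₁ where
  field
    Vertex     : Set
    order      : ℕ
    finite     : Vertex ↔ Fin order
    Adj        : Rel Vertex 0ℓ
    adj-sym    : Symmetric Adj
    adj-irrefl : Irreflexive _≡_ Adj

  infix 4 _≟_
  _≟_ : DecidableEquality Vertex
  _≟_ = via-injection (↔⇒↣ finite) Fin._≟_

------------------------------------------------------------------------
-- Words

-- The word a b a b ⋯ of length k.
alternating : {A : Set} → A → A → ℕ → List A
alternating a b zero    = []
alternating a b (suc k) = a ∷ alternating b a k

module _ {A : Set} (_≟_ : DecidableEquality A) where

  restrict : A → A → List A → List A
  restrict x y = filter (λ z → (z ≟ x) ⊎-dec (z ≟ y))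

  occurrences : A → List A → ℕ
  occurrences x w = length (filter (_≟ x) w)

  Alternate : List A → A → A → Set
  Alternate w x y =
    ∃[ k ] (restrict x y w ≡ alternating x y k ⊎ restrict x y w ≡ alternating y x k)

  Uniform : ℕ → List A → Set
  Uniform k w = ∀ x → occurrences x w ≡ k

module _ (G : Graph) where
  open Graph G

  Represents : List Vertex → Set
  Represents w =
    (∀ x → x ∈ w) × (∀ x y → x ≢ y → Alternate _≟_ w x y ⇔ Adj x y)

  UniformlyWordRepresentable : ℕ → Set
  UniformlyWordRepresentable k = ∃[ w ] (Uniform _≟_ k w × Represents w)

  -- A relation, since there is no such k when G is not word-representable.
  RepresentationNumber : ℕ → Set
  RepresentationNumber k =
    UniformlyWordRepresentable k × (∀ j → UniformlyWordRepresentable j → k ≤ j)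

------------------------------------------------------------------------
-- Circle graphs

-- The plane has rational coordinates.  This gives the same circle graphs as
-- the real plane.  Rational points are dense on a circle with rational centre
-- and radius, so the finitely many chords of a real model can be moved to
-- rational endpoints without changing which of them cross.  Conversely, if two
-- chords with rational endpoints cross over ℝ, they do so at a rational point.

Point : Set
Point = ℚ × ℚ

record Circle : Set where
  field
    centre   : Point
    radius   : ℚ
    radius>0 : 0ℚ < radius

dist² : Point → Point → ℚ
dist² (x₁ , y₁) (x₂ , y₂) = (x₁ - x₂) * (x₁ - x₂) + (y₁ - y₂) * (y₁ - y₂)

OnCircle : Circle → Point → Set
OnCircle C P = dist² P centre ≡ radius * radius
  where open Circle C

record Chord (C : Circle) : Set where
  field
    start end : Point
    start-on  : OnCircle C start
    end-on    : OnCircle C end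
    distinct  : start ≢ end

along : Point → Point → ℚ → Point
along (x₁ , y₁) (x₂ , y₂) t = x₁ + t * (x₂ - x₁) , y₁ + t * (y₂ - y₁)

Interior : {C : Circle} → Chord C → Point → Set
Interior c P = ∃[ t ] (0ℚ < t × t < 1ℚ × P ≡ along start end t)
  where open Chord c

Cross : {C : Circle} → Chord C → Chord C → Set
Cross c d = ∃[ P ] (Interior c P × Interior d P)

CircleGraph : Graph → Set
CircleGraph G =
  Σ[ C ∈ Circle ] Σ[ chord ∈ (Vertex → Chord C) ]
    (∀ x y → x ≢ y → Adj x y ⇔ Cross (chord x) (chord y))
  where open Graph G

------------------------------------------------------------------------
-- Ladder graphs

-- inj₁ i and inj₂ i are the vertices i and i′, numbered from 0.
LadderVertex : ℕ → Set
LadderVertex n = Fin n ⊎ Fin n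

data LadderEdge {n : ℕ} : Rel (LadderVertex n) 0ℓ where
  rail  : ∀ {i j} → toℕ j ≡ suc (toℕ i) → LadderEdge (inj₁ i) (inj₁ j)
  rail′ : ∀ {i j} → toℕ j ≡ suc (toℕ i) → LadderEdge (inj₂ i) (inj₂ j)
  rung  : ∀ i → LadderEdge (inj₁ i) (inj₂ i)

ladder-irrefl : ∀ {n} → Irreflexive _≡_ (SymClosure (LadderEdge {n}))
ladder-irrefl refl (fwd (rail  eq)) = ℕ.1+n≢n (sym eq)
ladder-irrefl refl (fwd (rail′ eq)) = ℕ.1+n≢n (sym eq)
ladder-irrefl refl (bwd (rail  eq)) = ℕ.1+n≢n (sym eq)
ladder-irrefl refl (bwd (rail′ eq)) = ℕ.1+n≢n (sym eq)

ladder : ℕ → Graph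
ladder n = record
  { Vertex     = LadderVertex n
  ; order      = n ℕ.+ n
  ; finite     = ↔-sym Fin.+↔⊎
  ; Adj        = SymClosure LadderEdge
  ; adj-sym    = SymClosure.symmetric LadderEdge
  ; adj-irrefl = ladder-irrefl
  }

-- The ladder graph is a permutation graph: the vertices i and i′ get the labels
-- code i and swap (code i), and the adjacent vertices are those on which the orders
-- by decreasing second and by increasing first label agree.  Listing the vertices
-- first in one order and then in the other gives a 2-uniform word whose restriction
-- to x and y is xyxy or xyyx.  Placing both listings one after the other along a
-- circle and joining the two copies of each vertex gives chords that interleave or
-- nest accordingly.  A 1-uniform word makes every pair of letters alternate, and a
-- ladder with two rungs has nonadjacent vertices, so 2 is optimal.
module Submission where

open import Defs
open import Data.Fin using (toℕ; zero; suc)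
open import Data.Fin.Properties using (toℕ-injective)
open import Data.Integer as ℤ using (ℤ; +_; -[1+_])
import Data.Integer.Properties as ℤ
open import Data.List using (List; []; _∷_; _++_; allFin; filter; length; map; replicate)
open import Data.List.Membership.Propositional using (_∈_)
open import Data.List.Membership.Propositional.Properties using (∈-allFin; ∈-map⁺)
open import Data.List.Properties
  using (filter-accept; filter-reject; filter-none; filter-some; filter-++; length-++)
open import Data.List.Relation.Binary.Permutation.Propositional using (_↭_)
open import Data.List.Relation.Binary.Permutation.Propositional.Properties
  using (filter-↭; ↭-length)
import Data.List.Relation.Unary.All as All
open import Data.List.Relation.Unary.AllPairs using (_∷_)
open import Data.List.Relation.Unary.Any as Any using (here; there)
import Data.List.Relation.Unary.Linked as Linked
import Data.List.Relation.Unary.Sorted.TotalOrder.Properties as Sorted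
open import Data.List.Relation.Unary.Unique.Propositional using (Unique)
open import Data.List.Relation.Unary.Unique.Propositional.Properties using (map⁺; allFin⁺)
import Data.List.Sort as Sort
open import Data.Nat as ℕ using (ℕ; suc; z≤n; s≤s; _≥_)
import Data.Nat.Properties as ℕ
open import Data.Nat.Coprimality as Coprimality using (1-coprimeTo)
open import Data.Product using (∃-syntax; _×_; _,_; proj₁; proj₂; swap)
open import Data.Rational as ℚ
  using (ℚ; mkℚ; 0ℚ; 1ℚ; ½; _+_; _-_; -_; _*_; 1/_; _<_; _≤_; *<*;
         positive; nonNegative; nonPositive)
open import Data.Rational.Properties
  using (+-mono-<; +-mono-<-≤; +-monoˡ-<; +-inverseʳ;
         +-identityˡ; *-identityˡ; *-identityʳ; *-assoc; *-inverseˡ; pos*pos⇒pos;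
         nonNeg*nonNeg⇒nonNeg; nonPos*nonPos⇒nonPos; positive⁻¹; nonNegative⁻¹;
         1/pos⇒pos; pos⇒nonZero; ≤-total; ≤-decTotalOrder; <-cmp; <⇒≢; <-≤-trans;
         <-asym; <-trans; <-irrefl)
open import Data.Rational.Solver using (module +-*-Solver)
open import Data.Sum using (_⊎_; inj₁; inj₂)
open import Function
  using (_∘_; _⇔_; mk⇔; Equivalence; Inverse; Injection; Injective)
open import Function.Properties.Inverse using (↔-sym; ↔⇒↣)
open import Level using (0ℓ)
open import Relation.Binary
  using (Rel; DecidableEquality; DecTotalOrder; tri<; tri≈; tri>)
open import Relation.Binary.Construct.Closure.Symmetric as SymClosure
  using (SymClosure; fwd; bwd)
import Relation.Binary.Construct.On as On
open import Relation.Binary.PropositionalEquality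
  using (_≡_; _≢_; refl; sym; trans; cong; cong₂; subst; subst₂; ≢-sym; module ≡-Reasoning)
open import Relation.Nullary using (¬_; yes; no; contradiction)
open import Relation.Nullary.Decidable using (_⊎-dec_)

open +-*-Solver using (Polynomial; solve; con; _:=_; _:+_; _:*_; _:-_)

-- Positivity and inverses in the rationals.

private
  variable
    p q s t u v : ℚ

+-pos : 0ℚ < p → 0ℚ < q → 0ℚ < p + q
+-pos = +-mono-<

*-pos : 0ℚ < p → 0ℚ < q → 0ℚ < p * q
*-pos {p} {q} 0<p 0<q =
  positive⁻¹ (p * q) {{pos*pos⇒pos p {{positive 0<p}} q {{positive 0<q}}}}

p<q⇒0<q-p : p < q → 0ℚ < q - p
p<q⇒0<q-p {p} {q} p<q = subst (_< q - p) (+-inverseʳ p) (+-monoˡ-< (- p) p<q)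

0<q-p⇒p<q : 0ℚ < q - p → p < q
0<q-p⇒p<q {q} {p} 0<q-p =
  subst₂ _<_ (+-identityˡ p) (cancel q p) (+-monoˡ-< p 0<q-p)
  where
  cancel = solve 2 (λ q p → q :- p :+ p := q) refl

0≤p*p : ∀ p → 0ℚ ≤ p * p
0≤p*p p with ≤-total 0ℚ p
... | inj₁ 0≤p = nonNegative⁻¹ (p * p) {{nonNeg*nonNeg⇒nonNeg p {{n}} p {{n}}}}
  where n = nonNegative 0≤p
... | inj₂ p≤0 = nonNegative⁻¹ (p * p) {{nonPos*nonPos⇒nonPos p {{n}} p {{n}}}}
  where n = nonPositive p≤0

invert : 0ℚ < p → ∃[ i ] (0ℚ < i × i * p ≡ 1ℚ)
invert {p} 0<p =
  (1/ p) , positive⁻¹ (1/ p) {{1/pos⇒pos p}} , *-inverseˡ p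
  where
  instance
    _ = positive 0<p
    _ = pos⇒nonZero p

-- A rational parametrisation of a circle, and its secant lines.

weight : ℚ → ℚ
weight q = 1ℚ + q * q

0<weight : ∀ q → 0ℚ < weight q
0<weight q = +-mono-<-≤ (positive⁻¹ 1ℚ) (0≤p*p q)

-- The factor by which inversion in the unit circle scales (1 , q), whose squared distance from the
-- origin is `weight q`.
scale : ℚ → ℚ
scale q = let i , _ = invert (0<weight q) in i

0<scale : ∀ q → 0ℚ < scale q
0<scale q = let _ , 0<i , _ = invert (0<weight q) in 0<i

scale*weight : ∀ q → scale q * weight q ≡ 1ℚ
scale*weight q = let _ , _ , eq = invert (0<weight q) in eq

point : ℚ → Point
point q = scale q , scale q * q

-- The image of the line x = 1 under inversion in the unit circle; point q is the
-- image of (1 , q).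
circle : Circle
circle = record { centre = ½ , 0ℚ ; radius = ½ ; radius>0 = positive⁻¹ ½ }

point-on : ∀ q → OnCircle circle (point q)
point-on q = begin
  (c - ½) * (c - ½) + (c * q - 0ℚ) * (c * q - 0ℚ)        ≡⟨ expand c q ½ ⟩
  -- `½ + ½` evaluates to the `1ℚ` of the next line.
  ½ * ½ + (c * (c * weight q) - (½ + ½) * c)
    ≡⟨ cong (λ z → ½ * ½ + (c * z - 1ℚ * c)) (scale*weight q) ⟩
  ½ * ½ + (c * 1ℚ - 1ℚ * c)                              ≡⟨ collapse ½ c ⟩
  ½ * ½                                                  ∎
  where
  open ≡-Reasoning
  c = scale q
  expand = solve 3 (λ c q h →
    (c :- h) :* (c :- h) :+ (c :* q :- con 0ℚ) :* (c :* q :- con 0ℚ)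
      := h :* h :+ (c :* (c :* (con 1ℚ :+ q :* q)) :- (h :+ h) :* c)) refl
  collapse = solve 2 (λ h c → h :* h :+ (c :* con 1ℚ :- con 1ℚ :* c) := h :* h) refl

-- Vanishes exactly on the line through point s and point t.
side : ℚ → ℚ → Point → ℚ
side s t (x , y) = (1ℚ - s * t) * x + (s + t) * y - 1ℚ

-- With the constant 1 written as `scale u * weight u`, the factor `scale u` comes out and leaves a
-- quadratic in u with roots s and t.
side-point : ∀ s t u → side s t (point u) ≡ scale u * ((u - s) * (t - u))
side-point s t u = begin
  (1ℚ - s * t) * c + (s + t) * (c * u) - 1ℚ
    ≡⟨ cong (λ z → (1ℚ - s * t) * c + (s + t) * (c * u) - z) (scale*weight u) ⟨
  (1ℚ - s * t) * c + (s + t) * (c * u) - c * weight u      ≡⟨ expand s t u c ⟩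
  c * ((u - s) * (t - u))                                  ∎
  where
  open ≡-Reasoning
  c = scale u
  expand = solve 4 (λ s t u c →
    (con 1ℚ :- s :* t) :* c :+ (s :+ t) :* (c :* u) :- c :* (con 1ℚ :+ u :* u)
      := c :* ((u :- s) :* (t :- u))) refl

side-along : ∀ s t P Q τ →
  side s t (along P Q τ) ≡ (1ℚ - τ) * side s t P + τ * side s t Q
side-along s t (x₁ , y₁) (x₂ , y₂) τ = affine (1ℚ - s * t) (s + t) x₁ y₁ x₂ y₂ τ
  where
  affine = solve 7 (λ a b x₁ y₁ x₂ y₂ τ →
    a :* (x₁ :+ τ :* (x₂ :- x₁)) :+ b :* (y₁ :+ τ :* (y₂ :- y₁)) :- con 1ℚ
      := (con 1ℚ :- τ) :* (a :* x₁ :+ b :* y₁ :- con 1ℚ)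
        :+ τ :* (a :* x₂ :+ b :* y₂ :- con 1ℚ)) refl

-- Equal abscissas have equal inverses, the weights; ordinate times weight is the parameter.
point-injective : point s ≡ point t → s ≡ t
point-injective {s} {t} eq = begin
  s                               ≡⟨ recover s ⟨
  ordinate (point s) * weight s   ≡⟨ cong₂ _*_ (cong ordinate eq) w≡ ⟩
  ordinate (point t) * weight t   ≡⟨ recover t ⟩
  t                               ∎
  where
  open ≡-Reasoning
  abscissa ordinate : Point → ℚ
  abscissa (x , _) = x
  ordinate (_ , y) = y
  commute = solve 3 (λ c q w → c :* q :* w := q :* (c :* w)) refl
  recover : ∀ q → scale q * q * weight q ≡ q
  recover q = trans (commute (scale q) q (weight q))
    (trans (cong (q *_) (scale*weight q)) (*-identityʳ q))
  w≡ : weight s ≡ weight t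
  w≡ = begin
    weight s                          ≡⟨ *-identityʳ _ ⟨
    weight s * 1ℚ                     ≡⟨ cong (weight s *_) (scale*weight t) ⟨
    weight s * (scale t * weight t)   ≡⟨ cong (λ c → weight s * (c * weight t)) (cong abscissa eq) ⟨
    weight s * (scale s * weight t)   ≡⟨ assoc (weight s) (scale s) (weight t) ⟩
    scale s * weight s * weight t     ≡⟨ cong (_* weight t) (scale*weight s) ⟩
    1ℚ * weight t                     ≡⟨ *-identityˡ _ ⟩
    weight t                          ∎
    where
    assoc = solve 3 (λ a b c → a :* (b :* c) := b :* a :* c) refl

-- Nested and interleaved chords.

chord : s < t → Chord circle
chord {s} {t} s<t = record
  { start    = point s
  ; end      = point t
  ; start-on = point-on s
  ; end-on   = point-on t
  ; distinct = λ eq → <⇒≢ s<t (point-injective eq)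
  }

side-self : ∀ (s<t : s < t) {P} → Interior (chord s<t) P → side s t P ≡ 0ℚ
side-self {s} {t} _ (τ , _ , _ , refl) = begin
  side s t (along (point s) (point t) τ)
    ≡⟨ side-along s t (point s) (point t) τ ⟩
  (1ℚ - τ) * side s t (point s) + τ * side s t (point t)
    ≡⟨ cong₂ (λ a b → (1ℚ - τ) * a + τ * b) (side-point s t s) (side-point s t t) ⟩
  (1ℚ - τ) * (c * ((s - s) * (t - s))) + τ * (d * ((t - s) * (t - t)))
    ≡⟨ vanish s t τ c d ⟩
  0ℚ ∎
  where
  open ≡-Reasoning
  c = scale s
  d = scale t
  vanish = solve 5 (λ s t τ c d →
    (con 1ℚ :- τ) :* (c :* ((s :- s) :* (t :- s))) :+ τ :* (d :* ((t :- s) :* (t :- t)))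
      := con 0ℚ) refl

-- By `side-point`, `side s t` is positive at both endpoints, hence by affinity between them.
side-nested : ∀ (u<v : u < v) {P} → s < u → v < t → Interior (chord u<v) P → 0ℚ < side s t P
side-nested {u} {v} {s} {t} u<v s<u v<t (τ , 0<τ , τ<1 , refl) =
  subst (0ℚ <_) (sym (side-along s t (point u) (point v) τ))
    (+-pos (*-pos (p<q⇒0<q-p τ<1) (inside s<u (<-trans u<v v<t)))
           (*-pos 0<τ (inside (<-trans s<u u<v) v<t)))
  where
  inside : ∀ {w} → s < w → w < t → 0ℚ < side s t (point w)
  inside {w} s<w w<t = subst (0ℚ <_) (sym (side-point s t w))
    (*-pos (0<scale w) (*-pos (p<q⇒0<q-p s<w) (p<q⇒0<q-p w<t)))

-- A common interior point would lie both on the line through `point s` and `point t` and strictly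
-- off it.
nested⇒¬cross : (s<t : s < t) (u<v : u < v) → s < u → v < t →
                ¬ Cross (chord s<t) (chord u<v)
nested⇒¬cross s<t u<v s<u v<t (P , on-st , on-uv) =
  <-irrefl (sym (side-self s<t on-st)) (side-nested u<v s<u v<t on-uv)

-- Brings unnormalised weights a and b into the form `along` asks for: the parameter is the share
-- `i * b` of the second endpoint.
weighted-interior : ∀ {a b i} → 0ℚ < a → 0ℚ < b → 0ℚ < i → i * (a + b) ≡ 1ℚ →
  ∀ x₁ y₁ x₂ y₂ → ∃[ τ ] (0ℚ < τ × τ < 1ℚ ×
    (i * (a * x₁ + b * x₂) , i * (a * y₁ + b * y₂)) ≡ along (x₁ , y₁) (x₂ , y₂) τ)
weighted-interior {a} {b} {i} 0<a 0<b 0<i i[a+b]≡1 x₁ y₁ x₂ y₂ =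
  i * b , *-pos 0<i 0<b , 0<q-p⇒p<q (subst (0ℚ <_) ia≡1-ib (*-pos 0<i 0<a)) ,
  cong₂ _,_ (coordinate x₁ x₂) (coordinate y₁ y₂)
  where
  open ≡-Reasoning
  split = solve 3 (λ i a b → i :* a := i :* (a :+ b) :- i :* b) refl
  ia≡1-ib : i * a ≡ 1ℚ - i * b
  ia≡1-ib = trans (split i a b) (cong (_- i * b) i[a+b]≡1)
  expand = solve 5 (λ i a b z₁ z₂ →
    i :* (a :* z₁ :+ b :* z₂)
      := i :* (a :+ b) :* z₁ :+ i :* b :* (z₂ :- z₁)) refl
  coordinate : ∀ z₁ z₂ → i * (a * z₁ + b * z₂) ≡ z₁ + i * b * (z₂ - z₁)
  coordinate z₁ z₂ = begin
    i * (a * z₁ + b * z₂)                   ≡⟨ expand i a b z₁ z₂ ⟩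
    i * (a + b) * z₁ + i * b * (z₂ - z₁)    ≡⟨ cong (λ z → z * z₁ + i * b * (z₂ - z₁)) i[a+b]≡1 ⟩
    1ℚ * z₁ + i * b * (z₂ - z₁)             ≡⟨ cong (_+ i * b * (z₂ - z₁)) (*-identityˡ z₁) ⟩
    z₁ + i * b * (z₂ - z₁)                  ∎

-- Clearing denominators in a third divided difference leaves at each of its four nodes, up to sign,
-- this product for the other three.
vandermonde : ℚ → ℚ → ℚ → ℚ
vandermonde p q r = (q - p) * (r - p) * (r - q)

0<vandermonde : ∀ {p q r} → p < q → q < r → 0ℚ < vandermonde p q r
0<vandermonde p<q q<r =
  *-pos (*-pos (p<q⇒0<q-p p<q) (p<q⇒0<q-p (<-trans p<q q<r))) (p<q⇒0<q-p q<r)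

-- The third divided difference annihilates polynomials of degree at most two.
-- For s < u < t < v its coefficients alternate in sign, so applied to 1, q and
-- weight q it exhibits a point which is a convex combination both of point s and
-- point t and of point u and point v.
interleaved⇒cross : (s<t : s < t) (u<v : u < v) → s < u → u < t → t < v →
                    Cross (chord s<t) (chord u<v)
interleaved⇒cross {s} {t} {u} {v} _ _ s<u u<t t<v =
  (i * (a * scale s + b * scale t) , i * (a * (scale s * s) + b * (scale t * t))) ,
  weighted-interior 0<a 0<b 0<i i[a+b]≡1 _ _ _ _ ,
  subst (λ P → ∃[ τ ] (0ℚ < τ × τ < 1ℚ × P ≡ along (point u) (point v) τ))
    (sym (cong₂ (λ x y → i * x , i * y) x≡ y≡))
    (weighted-interior 0<c 0<d 0<i
      -- By `quadratic`, a + b equals c + d, so one normaliser i serves both chords.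
      (trans (cong (i *_) (sym (quadratic s t u v))) i[a+b]≡1) _ _ _ _)
  where
  α = vandermonde u t v
  β = vandermonde s u v
  γ = vandermonde s t v
  δ = vandermonde s u t
  -- The factor `weight` cancels the `scale` in the coordinates of each endpoint.
  a = α * weight s
  b = β * weight t
  c = γ * weight u
  d = δ * weight v

  0<a = *-pos (0<vandermonde u<t t<v) (0<weight s)
  0<b = *-pos (0<vandermonde s<u (<-trans u<t t<v)) (0<weight t)
  0<c = *-pos (0<vandermonde (<-trans s<u u<t) t<v) (0<weight u)
  0<d = *-pos (0<vandermonde s<u u<t) (0<weight v)

  i = let i , _ = invert (+-pos 0<a 0<b) in i
  0<i = let _ , 0<i , _ = invert (+-pos 0<a 0<b) in 0<i
  i[a+b]≡1 = let _ , _ , eq = invert (+-pos 0<a 0<b) in eq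

  V : ∀ {n} → Polynomial n → Polynomial n → Polynomial n → Polynomial n
  V p q r = (q :- p) :* (r :- p) :* (r :- q)

  W : ∀ {n} → Polynomial n → Polynomial n
  W q = con 1ℚ :+ q :* q

  constant = solve 4 (λ s t u v →
    V u t v :+ V s u v := V s t v :+ V s u t) refl
  linear = solve 4 (λ s t u v →
    V u t v :* s :+ V s u v :* t := V s t v :* u :+ V s u t :* v) refl
  quadratic = solve 4 (λ s t u v →
    V u t v :* W s :+ V s u v :* W t := V s t v :* W u :+ V s u t :* W v) refl

  unweight-x : ∀ κ q → κ * weight q * scale q ≡ κ
  unweight-x κ q = trans (reassoc κ (weight q) (scale q))
    (trans (cong (κ *_) (scale*weight q)) (*-identityʳ κ))
    where
    reassoc = solve 3 (λ k w c → k :* w :* c := k :* (c :* w)) refl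
  unweight-y : ∀ κ q → κ * weight q * (scale q * q) ≡ κ * q
  unweight-y κ q = trans (sym (*-assoc (κ * weight q) (scale q) q)) (cong (_* q) (unweight-x κ q))

  x≡ : a * scale s + b * scale t ≡ c * scale u + d * scale v
  x≡ = trans (cong₂ _+_ (unweight-x α s) (unweight-x β t))
    (trans (constant s t u v) (sym (cong₂ _+_ (unweight-x γ u) (unweight-x δ v))))
  y≡ : a * (scale s * s) + b * (scale t * t) ≡ c * (scale u * u) + d * (scale v * v)
  y≡ = trans (cong₂ _+_ (unweight-y α s) (unweight-y β t))
    (trans (linear s t u v) (sym (cong₂ _+_ (unweight-y γ u) (unweight-y δ v))))

-- Occurrences of letters and restriction to two letters.

module _ {A : Set} (_≟_ : DecidableEquality A) where

  occurrences-++ : ∀ x v w →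
    occurrences _≟_ x (v ++ w) ≡ occurrences _≟_ x v ℕ.+ occurrences _≟_ x w
  occurrences-++ x v w =
    trans (cong length (filter-++ (_≟ x) v w)) (length-++ (filter (_≟ x) v))

  occurrences-↭ : ∀ x {v w} → v ↭ w → occurrences _≟_ x v ≡ occurrences _≟_ x w
  occurrences-↭ x = ↭-length ∘ filter-↭ (_≟ x)

  ∈⇒occurrences>0 : ∀ {x w} → x ∈ w → 0 ℕ.< occurrences _≟_ x w
  ∈⇒occurrences>0 {x} x∈w = filter-some (_≟ x) (Any.map sym x∈w)

  occurrences>0⇒∈ : ∀ {x} w → 0 ℕ.< occurrences _≟_ x w → x ∈ w
  occurrences>0⇒∈ {x} (z ∷ w) occ>0 with z ≟ x
  ... | yes refl = here refl
  ... | no _     = there (occurrences>0⇒∈ w occ>0)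

  unique⇒occurrences≡1 : ∀ {x w} → Unique w → x ∈ w → occurrences _≟_ x w ≡ 1
  unique⇒occurrences≡1 {x} {_ ∷ w} (x∉w ∷ _) (here refl)
    rewrite filter-accept (_≟ x) {x} {w} refl
          | filter-none (_≟ x) (All.map ≢-sym x∉w) = refl
  unique⇒occurrences≡1 {x} {z ∷ w} (z∉w ∷ w!) (there x∈w)
    rewrite filter-reject (_≟ x) {z} {w} (All.lookup z∉w x∈w) = unique⇒occurrences≡1 w! x∈w

  restrict-onlyˡ : ∀ x y w → occurrences _≟_ y w ≡ 0 →
    restrict _≟_ x y w ≡ replicate (occurrences _≟_ x w) x
  restrict-onlyˡ x y [] _ = refl
  restrict-onlyˡ x y (z ∷ w) occ with z ≟ x | z ≟ y
  ... | yes refl | no _ = cong (z ∷_) (restrict-onlyˡ x y w occ)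
  ... | no _     | no _ = restrict-onlyˡ x y w occ

  restrict-onlyʳ : ∀ x y w → occurrences _≟_ x w ≡ 0 →
    restrict _≟_ x y w ≡ replicate (occurrences _≟_ y w) y
  restrict-onlyʳ x y [] _ = refl
  restrict-onlyʳ x y (z ∷ w) occ with z ≟ x | z ≟ y
  ... | no _ | yes refl = cong (z ∷_) (restrict-onlyʳ x y w occ)
  ... | no _ | no _     = restrict-onlyʳ x y w occ

  restrict-pair : ∀ {x y} w → x ≢ y → occurrences _≟_ x w ≡ 1 → occurrences _≟_ y w ≡ 1 →
    restrict _≟_ x y w ≡ x ∷ y ∷ [] ⊎ restrict _≟_ x y w ≡ y ∷ x ∷ []
  restrict-pair {x} {y} (z ∷ w) x≢y occ-x occ-y with z ≟ x | z ≟ y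
  ... | yes refl | yes refl = contradiction refl x≢y
  ... | yes refl | no _     = inj₁ (cong (z ∷_)
    (trans (restrict-onlyʳ x y w (ℕ.suc-injective occ-x)) (cong (λ k → replicate k y) occ-y)))
  ... | no _     | yes refl = inj₂ (cong (z ∷_)
    (trans (restrict-onlyˡ x y w (ℕ.suc-injective occ-y)) (cong (λ k → replicate k x) occ-x)))
  ... | no _     | no _     = restrict-pair w x≢y occ-x occ-y

  uniform-1⇒alternate : ∀ w {x y} → Uniform _≟_ 1 w → x ≢ y → Alternate _≟_ w x y
  uniform-1⇒alternate w {x} {y} uniform x≢y =
    2 , restrict-pair w x≢y (uniform x) (uniform y)

-- The first and third letters of an alternating word agree, which would force x and y to be equal.
abba≢alternating : {A : Set} {x y a b : A} {w : List A} → x ≢ y →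
                   ∀ k → x ∷ y ∷ y ∷ w ≢ alternating a b k
abba≢alternating x≢y (suc (suc (suc k))) refl = x≢y refl

-- Vertex lists, the lower bound, and sorting by a key.

module _ (G : Graph) where
  open Graph G

  vertices : List Vertex
  vertices = map (Inverse.from finite) (allFin order)

  occurrences-vertices : ∀ x → occurrences _≟_ x vertices ≡ 1
  occurrences-vertices x = unique⇒occurrences≡1 _≟_
    (map⁺ (Injection.injective (↔⇒↣ (↔-sym finite))) (allFin⁺ order))
    (subst (_∈ vertices) (Inverse.strictlyInverseʳ finite x)
      (∈-map⁺ (Inverse.from finite) (∈-allFin (Inverse.to finite x))))

  -- A 0-uniform word misses the vertices that must occur; a 1-uniform one makes the nonadjacent x
  -- and y alternate.
  nonadjacent⇒2≤ : ∀ {x y} → x ≢ y → ¬ Adj x y →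
                   ∀ k → UniformlyWordRepresentable G k → 2 ℕ.≤ k
  nonadjacent⇒2≤ {x} _ _ 0 (w , uniform , occurs , _) =
    contradiction (∈⇒occurrences>0 _≟_ (occurs x)) (ℕ.≤⇒≯ (ℕ.≤-reflexive (uniform x)))
  nonadjacent⇒2≤ {x} {y} x≢y ¬adj 1 (w , uniform , _ , edges) =
    contradiction (Equivalence.to (edges x y x≢y) (uniform-1⇒alternate _≟_ w uniform x≢y)) ¬adj
  nonadjacent⇒2≤ _ _ (suc (suc k)) _ = s≤s (s≤s z≤n)

  module SortedBy (key : Vertex → ℚ) where

    order-by : DecTotalOrder 0ℓ 0ℓ 0ℓ
    order-by = On.decTotalOrder ≤-decTotalOrder key

    open Sort order-by

    word : List Vertex
    word = sort vertices

    occurrences-word : ∀ x → occurrences _≟_ x word ≡ 1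
    occurrences-word x =
      trans (occurrences-↭ _≟_ x (sort-↭ vertices)) (occurrences-vertices x)

    -- Filtering keeps a sorted list sorted, so the two surviving letters stand in key order.
    word-ordered : ∀ {x y a b} → restrict _≟_ x y word ≡ a ∷ b ∷ [] → key a ≤ key b
    word-ordered {x} {y} eq = Linked.head (subst (Linked.Linked _) eq
      (Sorted.filter⁺ (DecTotalOrder.totalOrder order-by)
        (λ z → (z ≟ x) ⊎-dec (z ≟ y)) (sort-↗ vertices)))

    key<⇒xy : ∀ {x y} → key x < key y → restrict _≟_ x y word ≡ x ∷ y ∷ []
    key<⇒xy {x} {y} x<y
      with restrict-pair _≟_ word (λ { refl → <-irrefl refl x<y })
             (occurrences-word x) (occurrences-word y)
    ... | inj₁ xy = xy
    ... | inj₂ yx = contradiction (<-≤-trans x<y (word-ordered yx)) (<-irrefl refl)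

    key>⇒yx : ∀ {x y} → key y < key x → restrict _≟_ x y word ≡ y ∷ x ∷ []
    key>⇒yx {x} {y} y<x
      with restrict-pair _≟_ word (λ { refl → <-irrefl refl y<x })
             (occurrences-word x) (occurrences-word y)
    ... | inj₁ xy = contradiction (<-≤-trans y<x (word-ordered xy)) (<-irrefl refl)
    ... | inj₂ yx = yx

-- Permutation graphs, their words and their chords.

cross-sym : {C : Circle} (c d : Chord C) → Cross c d → Cross d c
cross-sym _ _ (P , on-c , on-d) = P , on-d , on-c

-- An intersection of two orders; for injective s and t its comparability graph is a permutation
-- graph.
Precedes : {A : Set} → (A → ℚ) → (A → ℚ) → Rel A 0ℓ
Precedes s t x y = s x < s y × t x < t y

-- A realizer of G as a permutation graph, up to reversing one of the two orders.
module Realizer (G : Graph) (s t : Graph.Vertex G → ℚ)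
  (s-injective : Injective _≡_ _≡_ s) (t-injective : Injective _≡_ _≡_ t)
  (adjacent : ∀ x y → Graph.Adj G x y ⇔ SymClosure (Precedes s t) x y) where

  open Graph G

  -- Ties being excluded, these sign patterns decide adjacency, alternation and crossing alike.
  data Relative (x y : Vertex) : Set where
    lt-lt : s x < s y → t x < t y → Relative x y
    lt-gt : s x < s y → t y < t x → Relative x y
    gt-lt : s y < s x → t x < t y → Relative x y
    gt-gt : s y < s x → t y < t x → Relative x y

  relative : ∀ {x y} → x ≢ y → Relative x y
  relative {x} {y} x≢y with <-cmp (s x) (s y) | <-cmp (t x) (t y)
  ... | tri≈ _ eq _ | _           = contradiction (s-injective eq) x≢y
  ... | _           | tri≈ _ eq _ = contradiction (t-injective eq) x≢y
  ... | tri< s< _ _ | tri< t< _ _ = lt-lt s< t<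
  ... | tri< s< _ _ | tri> _ _ t> = lt-gt s< t>
  ... | tri> _ _ s> | tri< t< _ _ = gt-lt s> t<
  ... | tri> _ _ s> | tri> _ _ t> = gt-gt s> t>

  lt-gt⇒¬adj : ∀ {x y} → s x < s y → t y < t x → ¬ Adj x y
  lt-gt⇒¬adj {x} {y} s< t> adj with Equivalence.to (adjacent x y) adj
  ... | fwd (_ , t<) = <-asym t< t>
  ... | bwd (s> , _) = <-asym s< s>

  module S = SortedBy G s
  module T = SortedBy G t

  word : List Vertex
  word = S.word ++ T.word

  word-uniform : Uniform _≟_ 2 word
  word-uniform x = trans (occurrences-++ _≟_ x S.word T.word)
    (cong₂ ℕ._+_ (S.occurrences-word x) (T.occurrences-word x))

  restrict-word : ∀ {x y u v} → restrict _≟_ x y S.word ≡ u → restrict _≟_ x y T.word ≡ v →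
                  restrict _≟_ x y word ≡ u ++ v
  restrict-word {x} {y} u v =
    trans (filter-++ (λ z → (z ≟ x) ⊎-dec (z ≟ y)) S.word T.word) (cong₂ _++_ u v)

  abba⇒¬alternate : ∀ {x y a b} → a ≢ b → restrict _≟_ x y word ≡ a ∷ b ∷ b ∷ a ∷ [] →
                    ¬ Alternate _≟_ word x y
  abba⇒¬alternate a≢b abba (k , inj₁ eq) = abba≢alternating a≢b k (trans (sym abba) eq)
  abba⇒¬alternate a≢b abba (k , inj₂ eq) = abba≢alternating a≢b k (trans (sym abba) eq)

  -- The four patterns give the restrictions xyxy, yxyx, xyyx and yxxy, of which only the first two
  -- alternate.
  alternate⇔adj : ∀ x y → x ≢ y → Alternate _≟_ word x y ⇔ Adj x y
  alternate⇔adj x y x≢y with relative x≢y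
  ... | lt-lt s< t< = mk⇔
    (λ _ → Equivalence.from (adjacent x y) (fwd (s< , t<)))
    (λ _ → 4 , inj₁ (restrict-word (S.key<⇒xy s<) (T.key<⇒xy t<)))
  ... | gt-gt s> t> = mk⇔
    (λ _ → Equivalence.from (adjacent x y) (bwd (s> , t>)))
    (λ _ → 4 , inj₂ (restrict-word (S.key>⇒yx s>) (T.key>⇒yx t>)))
  ... | lt-gt s< t> = mk⇔
    (λ alt → contradiction alt
      (abba⇒¬alternate x≢y (restrict-word (S.key<⇒xy s<) (T.key>⇒yx t>))))
    (λ adj → contradiction adj (lt-gt⇒¬adj s< t>))
  ... | gt-lt s> t< = mk⇔
    (λ alt → contradiction alt
      (abba⇒¬alternate (≢-sym x≢y) (restrict-word (S.key>⇒yx s>) (T.key<⇒xy t<))))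
    (λ adj → contradiction (adj-sym adj) (lt-gt⇒¬adj s> t<))

  2-representable : UniformlyWordRepresentable G 2
  2-representable =
    word , word-uniform ,
    (λ x → occurrences>0⇒∈ _≟_ word (subst (0 ℕ.<_) (sym (word-uniform x)) (s≤s z≤n))) ,
    alternate⇔adj

  circleGraph : (∀ x y → s x < t y) → CircleGraph G
  circleGraph s<t = circle , c , adj⇔cross
    where
    c : Vertex → Chord circle
    c x = chord (s<t x x)

    adj⇔cross : ∀ x y → x ≢ y → Adj x y ⇔ Cross (c x) (c y)
    adj⇔cross x y x≢y with relative x≢y
    ... | lt-lt s< t< = mk⇔
      -- The mixed inequality s y < t x makes the chords interleave instead of lying apart.
      (λ _ → interleaved⇒cross (s<t x x) (s<t y y) s< (s<t y x) t<)
      (λ _ → Equivalence.from (adjacent x y) (fwd (s< , t<)))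
    ... | gt-gt s> t> = mk⇔
      (λ _ → cross-sym (c y) (c x) (interleaved⇒cross (s<t y y) (s<t x x) s> (s<t x y) t>))
      (λ _ → Equivalence.from (adjacent x y) (bwd (s> , t>)))
    ... | lt-gt s< t> = mk⇔
      (λ adj → contradiction adj (lt-gt⇒¬adj s< t>))
      (λ cross → contradiction cross (nested⇒¬cross (s<t x x) (s<t y y) s< t>))
    ... | gt-lt s> t< = mk⇔
      (λ adj → contradiction (adj-sym adj) (lt-gt⇒¬adj s> t<))
      (λ cross → contradiction (cross-sym (c x) (c y) cross)
        (nested⇒¬cross (s<t y y) (s<t x x) s> t<))

-- Integers as rationals, and number pairs coding the rungs.

fromℤ : ℤ → ℚ
-- The 0 is the denominator minus one. With `mkℚ` the numerator computes to i, from which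
-- injectivity is read off later.
fromℤ i = mkℚ i 0 (Coprimality.sym (1-coprimeTo ℤ.∣ i ∣))

fromℤ-mono-< : ∀ {i j} → i ℤ.< j → fromℤ i < fromℤ j
fromℤ-mono-< i<j = *<* (subst₂ ℤ._<_ (sym (ℤ.*-identityʳ _)) (sym (ℤ.*-identityʳ _)) i<j)

fromℤ-cancel-< : ∀ {i j} → fromℤ i < fromℤ j → i ℤ.< j
fromℤ-cancel-< (*<* i<j) = subst₂ ℤ._<_ (ℤ.*-identityʳ _) (ℤ.*-identityʳ _) i<j

-- (l , r) stands for the chord from -(1 + r) to l, so it crosses exactly those
-- chords whose l and r differ from its own in opposite directions.
_⋈_ : Rel (ℕ × ℕ) 0ℓ
_⋈_ = SymClosure (λ (l₁ , r₁) (l₂ , r₂) → l₁ ℕ.< l₂ × r₂ ℕ.< r₁)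

swap-⋈ : ∀ {p q} → p ⋈ q → swap p ⋈ swap q
swap-⋈ (fwd (l< , r>)) = bwd (r> , l<)
swap-⋈ (bwd (l> , r<)) = fwd (r< , l>)

-- One rung further: since it preserves and reflects `_⋈_`, comparing two rungs reduces to the case
-- where one index is 0.
step : ℕ × ℕ → ℕ × ℕ
step (l , r) = 2 ℕ.+ r , 2 ℕ.+ l

step-⋈ : ∀ {p q} → p ⋈ q → step p ⋈ step q
step-⋈ (fwd (l< , r>)) = bwd (s≤s (s≤s r>) , s≤s (s≤s l<))
step-⋈ (bwd (l> , r<)) = fwd (s≤s (s≤s r<) , s≤s (s≤s l>))

step-⋈⁻¹ : ∀ {p q} → step p ⋈ step q → p ⋈ q
step-⋈⁻¹ (fwd (s≤s (s≤s l<) , s≤s (s≤s r>))) = bwd (r> , l<)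
step-⋈⁻¹ (bwd (s≤s (s≤s l>) , s≤s (s≤s r<))) = fwd (r< , l>)

-- (2i + 1 , 2i + 4) for even i, and (2i + 4 , 2i + 1) for odd i.
code : ℕ → ℕ × ℕ
code 0       = 1 , 4
code (suc i) = step (code i)

code-suc : ∀ i → code i ⋈ code (suc i)
code-suc 0       = fwd (s≤s (s≤s z≤n) , ℕ.≤-refl)
code-suc (suc i) = step-⋈ (code-suc i)

code-rung : ∀ i → code i ⋈ swap (code i)
code-rung 0       = fwd (s≤s (s≤s z≤n) , s≤s (s≤s z≤n))
-- `swap` and `step` commute definitionally.
code-rung (suc i) = step-⋈ (code-rung i)

-- From index 2 on both coordinates exceed 4, the larger one of `code 0`, so the differences have
-- the same direction.
code-rail⁻¹ : ∀ i j → code i ⋈ code j → j ≡ suc i ⊎ i ≡ suc j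
code-rail⁻¹ 0 0 (fwd (s≤s () , _))
code-rail⁻¹ 0 0 (bwd (s≤s () , _))
code-rail⁻¹ 0 1 _ = inj₁ refl
code-rail⁻¹ 0 (suc (suc j)) (fwd (_ , s≤s (s≤s (s≤s (s≤s ())))))
code-rail⁻¹ 0 (suc (suc j)) (bwd (s≤s () , _))
code-rail⁻¹ 1 0 _ = inj₂ refl
code-rail⁻¹ (suc (suc i)) 0 (fwd (s≤s () , _))
code-rail⁻¹ (suc (suc i)) 0 (bwd (_ , s≤s (s≤s (s≤s (s≤s ())))))
code-rail⁻¹ (suc i) (suc j) c with code-rail⁻¹ i j (step-⋈⁻¹ c)
... | inj₁ eq = inj₁ (cong suc eq)
... | inj₂ eq = inj₂ (cong suc eq)

-- Here index 1 fails too: (3 , 6) exceeds (1 , 4) in both coordinates, and (6 , 3) exceeds (4 , 1).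
code-rung⁻¹ : ∀ i j → code i ⋈ swap (code j) → i ≡ j
code-rung⁻¹ 0 0 _ = refl
code-rung⁻¹ 0 1 (fwd (_ , s≤s (s≤s (s≤s (s≤s ())))))
code-rung⁻¹ 0 1 (bwd (s≤s () , _))
code-rung⁻¹ 0 (suc (suc j)) (fwd (_ , s≤s (s≤s (s≤s (s≤s ())))))
code-rung⁻¹ 0 (suc (suc j)) (bwd (s≤s () , _))
code-rung⁻¹ 1 0 (fwd (s≤s (s≤s (s≤s (s≤s ()))) , _))
code-rung⁻¹ 1 0 (bwd (_ , s≤s ()))
code-rung⁻¹ (suc (suc i)) 0 (fwd (s≤s (s≤s (s≤s (s≤s ()))) , _))
code-rung⁻¹ (suc (suc i)) 0 (bwd (_ , s≤s ()))
code-rung⁻¹ (suc i) (suc j) c = cong suc (code-rung⁻¹ i j (step-⋈⁻¹ c))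

-- Mutual with the next proof because `step` exchanges the coordinates.
code₁-injective : ∀ i j → proj₁ (code i) ≡ proj₁ (code j) → i ≡ j
code₂-injective : ∀ i j → proj₂ (code i) ≡ proj₂ (code j) → i ≡ j

code₁-injective 0       0       _  = refl
code₁-injective (suc i) (suc j) eq =
  cong suc (code₂-injective i j (ℕ.suc-injective (ℕ.suc-injective eq)))

code₂-injective 0 0 _ = refl
code₂-injective 0 1 ()
code₂-injective 0 2 ()
-- Each step exposes two successors, so three are unfolded to exceed the base value 4.
code₂-injective 0 (suc (suc (suc j))) ()
code₂-injective 1 0 ()
code₂-injective 2 0 ()
code₂-injective (suc (suc (suc i))) 0 ()
code₂-injective (suc i) (suc j) eq =
  cong suc (code₁-injective i j (ℕ.suc-injective (ℕ.suc-injective eq)))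

-- First coordinates are 1 or 2 modulo 4, second ones 0 or 3. This keeps the labels of i and j′
-- apart.
code₁≢code₂ : ∀ i j → proj₁ (code i) ≢ proj₂ (code j)
code₁≢code₂ 0 0 ()
code₁≢code₂ 0 (suc j) ()
code₁≢code₂ 1 0 ()
code₁≢code₂ 2 0 ()
code₁≢code₂ (suc (suc (suc i))) 0 ()
code₁≢code₂ (suc i) (suc j) eq =
  code₁≢code₂ j i (sym (ℕ.suc-injective (ℕ.suc-injective eq)))

-- The ladder as a permutation graph.

module _ {n : ℕ} where

  -- The swap reflects the endpoints of the chord by x ↦ -1 - x.
  label : LadderVertex n → ℕ × ℕ
  label (inj₁ i) = code (toℕ i)
  label (inj₂ i) = swap (code (toℕ i))

  label₁-injective : Injective _≡_ _≡_ (proj₁ ∘ label)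
  label₁-injective {inj₁ i} {inj₁ j} eq = cong inj₁ (toℕ-injective (code₁-injective _ _ eq))
  label₁-injective {inj₁ i} {inj₂ j} eq = contradiction eq (code₁≢code₂ (toℕ i) (toℕ j))
  label₁-injective {inj₂ i} {inj₁ j} eq = contradiction (sym eq) (code₁≢code₂ (toℕ j) (toℕ i))
  label₁-injective {inj₂ i} {inj₂ j} eq = cong inj₂ (toℕ-injective (code₂-injective _ _ eq))

  label₂-injective : Injective _≡_ _≡_ (proj₂ ∘ label)
  label₂-injective {inj₁ i} {inj₁ j} eq = cong inj₁ (toℕ-injective (code₂-injective _ _ eq))
  label₂-injective {inj₁ i} {inj₂ j} eq = contradiction (sym eq) (code₁≢code₂ (toℕ j) (toℕ i))
  label₂-injective {inj₂ i} {inj₁ j} eq = contradiction eq (code₁≢code₂ (toℕ i) (toℕ j))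
  label₂-injective {inj₂ i} {inj₂ j} eq = cong inj₂ (toℕ-injective (code₁-injective _ _ eq))

  edge⇒⋈ : ∀ {x y} → LadderEdge x y → label x ⋈ label y
  edge⇒⋈ (rail {i} {j} eq)  rewrite eq = code-suc (toℕ i)
  edge⇒⋈ (rail′ {i} {j} eq) rewrite eq = swap-⋈ (code-suc (toℕ i))
  edge⇒⋈ (rung i) = code-rung (toℕ i)

  ⋈⇒adj : ∀ x y → label x ⋈ label y → SymClosure LadderEdge x y
  ⋈⇒adj (inj₁ i) (inj₁ j) c with code-rail⁻¹ (toℕ i) (toℕ j) c
  ... | inj₁ eq = fwd (rail eq)
  ... | inj₂ eq = bwd (rail eq)
  ⋈⇒adj (inj₂ i) (inj₂ j) c with code-rail⁻¹ (toℕ i) (toℕ j) (swap-⋈ c)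
  ... | inj₁ eq = fwd (rail′ eq)
  ... | inj₂ eq = bwd (rail′ eq)
  ⋈⇒adj (inj₁ i) (inj₂ j) c with toℕ-injective (code-rung⁻¹ (toℕ i) (toℕ j) c)
  ... | refl = fwd (rung i)
  ⋈⇒adj (inj₂ i) (inj₁ j) c with toℕ-injective (code-rung⁻¹ (toℕ i) (toℕ j) (swap-⋈ c))
  ... | refl = bwd (rung i)

  -- Negation puts every left end below every right end and reverses the order, so the opposite
  -- directions in `_⋈_` become the agreeing ones in `Precedes`.
  left right : LadderVertex n → ℚ
  left  x = fromℤ -[1+ proj₂ (label x) ]
  right x = fromℤ (+ proj₁ (label x))

  left<right : ∀ x y → left x < right y
  left<right x y = fromℤ-mono-< ℤ.-<+

  left-injective : Injective _≡_ _≡_ left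
  left-injective eq = label₂-injective (ℤ.-[1+-injective (cong ℚ.numerator eq))

  right-injective : Injective _≡_ _≡_ right
  right-injective eq = label₁-injective (ℤ.+-injective (cong ℚ.numerator eq))

  ⋈⇒precedes : ∀ {x y} → label x ⋈ label y → SymClosure (Precedes left right) x y
  ⋈⇒precedes (fwd (l< , r>)) = fwd (fromℤ-mono-< (ℤ.-<- r>) , fromℤ-mono-< (ℤ.+<+ l<))
  ⋈⇒precedes (bwd (l> , r<)) = bwd (fromℤ-mono-< (ℤ.-<- r<) , fromℤ-mono-< (ℤ.+<+ l>))

  precedes⇒⋈ : ∀ {x y} → SymClosure (Precedes left right) x y → label x ⋈ label y
  precedes⇒⋈ (fwd (s< , t<)) =
    fwd (ℤ.drop‿+<+ (fromℤ-cancel-< t<) , ℤ.drop‿-<- (fromℤ-cancel-< s<))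
  precedes⇒⋈ (bwd (s> , t>)) =
    bwd (ℤ.drop‿+<+ (fromℤ-cancel-< t>) , ℤ.drop‿-<- (fromℤ-cancel-< s>))

  adj⇔precedes : ∀ x y → SymClosure LadderEdge x y ⇔ SymClosure (Precedes left right) x y
  adj⇔precedes x y = mk⇔
    (⋈⇒precedes ∘ SymClosure.fold (SymClosure.symmetric _) edge⇒⋈)
    (⋈⇒adj x y ∘ precedes⇒⋈)

module LadderRealizer (n : ℕ) =
  Realizer (ladder n) left right left-injective right-injective adj⇔precedes

theorem19 : (∀ (n : ℕ) → n ≥ 2 → RepresentationNumber (ladder n) 2)
    × (∀ (n : ℕ) → n ≥ 1 → CircleGraph (ladder n))
theorem19 =
  (λ { 1 (s≤s ())
     ; n@(suc (suc _)) _ →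
         LadderRealizer.2-representable n ,
         -- The nonadjacent pair consists of 1 and 2′.
         nonadjacent⇒2≤ (ladder n) {inj₁ zero} {inj₂ (suc zero)} (λ ())
           (λ { (fwd ()) ; (bwd ()) }) }) ,
  (λ n _ → LadderRealizer.circleGraph n left<right)
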